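{- Every connected $\{K_2+2K_1, P_4, C_4\}$-free graph $G$ (finite, simple, undirected, with $n \ge 2$ vertices) is well-burnable, i.e. $b(G) \leq \lceil \sqrt{n}\, \rceil$.
   Context: A graph is $\{K_2+2K_1, P_4, C_4\}$-free if it contains none of the following as an induced subgraph: $K_2+2K_1$ (the four-vertex graph that is the disjoint union of one edge and two isolated vertices), $P_4$ (the path on four vertices), $C_4$ (the cycle on four vertices). Graph burning: initially all vertices of a finite simple undirected graph $G$ are unburned. The process runs in rounds $t = 1, 2, 3, \dots$. In round $t$, a vertex $x_t$ that is not burned at the end of round $t-1$ is chosen as a new source of fire and becomes burned; simultaneously, every vertex adjacent to a vertex that was burned at the end of round $t-1$ becomes burned. Burned vertices remain burned. The process ends at the first round after which all vertices of $G$ are burned. The burning number $b(G)$ is the minimum, over all choices of sources, of the number of rounds needed to burn all vertices of $G$. A connected graph $G$ on $n$ vertices is called well-burnable if $b(G) \leq \lceil \sqrt{n}\, \rceil$. -}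

module Defs where

open import Data.Empty using (⊥-elim)
open import Data.Fin using (Fin; #_)
open import Data.Fin.Properties using (_≟_; all?; any?; ¬∀⟶∃¬)
open import Data.Fin.Subset using (Subset; _∈_; _∉_; _∪_; ⁅_⁆; ⊥; _⊂_; _⊃_)
open import Data.Fin.Subset.Induction using (⊃-wellFounded)
open import Data.Fin.Subset.Properties
  using (_∈?_; p⊆p∪q; q⊆p∪q; x∈⁅x⁆)
open import Data.List using (List; []; _∷_)
open import Data.List.Membership.Propositional using () renaming (_∈_ to _∈ˡ_)
open import Data.List.Membership.DecPropositional using () renaming (_∈?_ to ∈ˡ-dec)
open import Data.List.Relation.Unary.All using (All)
open import Data.Nat using (ℕ; zero; suc; _≤_; _*_; _≤?_; z≤n; s≤s)
open import Data.Nat.Properties using (m≤m*n)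
open import Data.Product using (_×_; _,_; ∃; ∃-syntax; proj₁; proj₂)
open import Data.Product.Properties using (≡-dec)
open import Data.Sum using (_⊎_; swap)
open import Data.Vec using (Vec; []; _∷_; tabulate)
open import Function using (_∘_)
open import Function.Bundles using (_⇔_)
open import Function.Definitions using (Injective)
open import Induction.WellFounded using (Acc; acc)
open import Level using (0ℓ)
open import Relation.Binary.Core using (Rel)
open import Relation.Binary.Construct.Closure.ReflexiveTransitive using (Star)
open import Relation.Binary.Definitions using (Symmetric; Irreflexive; Decidable)
open import Relation.Binary.PropositionalEquality using (_≡_; _≢_; sym)
open import Relation.Nullary using (¬_; Dec; yes; no; does)
open import Relation.Nullary.Decidable using (¬?; _×-dec_; _⊎-dec_; map′)
import Relation.Unary as Unary

-- Finite simple undirected graphs on the vertex set Fin n.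

record Graph (n : ℕ) : Set₁ where
  field
    Adj    : Rel (Fin n) 0ℓ
    adj?   : Decidable Adj
    symm   : Symmetric Adj
    irrefl : Irreflexive _≡_ Adj

open Graph public

Connected : ∀ {n} → Graph n → Set
Connected G = ∀ u v → Star (Adj G) u v

fromEdges : ∀ {n} → List (Fin n × Fin n) → Graph n
fromEdges es = record
  { Adj    = λ u v → u ≢ v × ((u , v) ∈ˡ es ⊎ (v , u) ∈ˡ es)
  ; adj?   = λ u v → ¬? (u ≟ v) ×-dec (mem? (u , v) es ⊎-dec mem? (v , u) es)
  ; symm   = λ (u≢v , e) → u≢v ∘ sym , swap e
  ; irrefl = λ u≡v (u≢v , _) → u≢v u≡v
  }
  where mem? = ∈ˡ-dec (≡-dec _≟_ _≟_)

K₂+2K₁ P₄ C₄ : Graph 4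
K₂+2K₁ = fromEdges ((# 0 , # 1) ∷ [])
P₄     = fromEdges ((# 0 , # 1) ∷ (# 1 , # 2) ∷ (# 2 , # 3) ∷ [])
C₄     = fromEdges ((# 0 , # 1) ∷ (# 1 , # 2) ∷ (# 2 , # 3) ∷ (# 3 , # 0) ∷ [])

-- G has an induced subgraph isomorphic to H.
_InducedIn_ : ∀ {m n} → Graph m → Graph n → Set
_InducedIn_ {m} {n} H G =
  ∃ λ (f : Fin m → Fin n) →
    Injective _≡_ _≡_ f × (∀ i j → Adj H i j ⇔ Adj G (f i) (f j))

_-Free_ : ∀ {m n} → List (Graph m) → Graph n → Set₁
Hs -Free G = All (λ H → ¬ (H InducedIn G)) Hs

IsMinimum : (ℕ → Set) → ℕ → Set
IsMinimum P m = P m × (∀ k → P k → m ≤ k)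

minimum : ∀ {P : ℕ → Set} → Unary.Decidable P → ∀ k → P k → ∃ (IsMinimum P)
minimum P? zero    p = 0 , p , λ _ _ → z≤n
minimum P? (suc k) p with P? 0
... | yes p₀ = 0 , p₀ , λ _ _ → z≤n
... | no ¬p₀ with minimum (P? ∘ suc) k p
...   | m , pₘ , least = suc m , pₘ , λ where
          zero    q → ⊥-elim (¬p₀ q)
          (suc j) q → s≤s (least j q)

-- ⌈√ n ⌉ is the least natural number k with √n ≤ k, i.e. with n ≤ k².
⌈√_⌉-spec : ∀ n → ∃ (IsMinimum (λ k → n ≤ k * k))
⌈√ n ⌉-spec = minimum (λ k → n ≤? k * k) n (n≤n*n n)
  where
  n≤n*n : ∀ n → n ≤ n * n
  n≤n*n zero    = z≤n
  n≤n*n (suc n) = m≤m*n (suc n) (suc n)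

⌈√_⌉ : ℕ → ℕ
⌈√ n ⌉ = proj₁ ⌈√ n ⌉-spec

module _ {n} (G : Graph n) where

  neighbours : Subset n → Subset n
  neighbours B = tabulate λ v → does (any? λ u → (u ∈? B) ×-dec adj? G u v)

  -- The burned set at the end of a round that starts with burned set B and
  -- whose new source is x.
  burnRound : Subset n → Fin n → Subset n
  burnRound B x = ⁅ x ⁆ ∪ (B ∪ neighbours B)

  -- Starting from burned set B, the sources x₁ … xₖ are legal choices for k
  -- further rounds, after which every vertex is burned. As each source must be
  -- unburned when its round starts, the process cannot have ended earlier.
  BurnsFrom : ∀ {k} → Subset n → Vec (Fin n) k → Set
  BurnsFrom B []       = ∀ v → v ∈ B
  BurnsFrom B (x ∷ xs) = x ∉ B × BurnsFrom (burnRound B x) xs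

  BurnableIn : ℕ → Set
  BurnableIn k = ∃[ xs ] BurnsFrom {k} ⊥ xs

  burnsFrom? : ∀ k B → Dec (∃[ xs ] BurnsFrom {k} B xs)
  burnsFrom? zero    B = map′ (λ all → [] , all) (λ { ([] , all) → all })
                              (all? (_∈? B))
  burnsFrom? (suc k) B =
    map′ (λ { (x , x∉B , xs , b) → x ∷ xs , x∉B , b })
         (λ { (x ∷ xs , x∉B , b) → x , x∉B , xs , b })
         (any? λ x → ¬? (x ∈? B) ×-dec burnsFrom? k (burnRound B x))

  -- Choosing arbitrary unburned sources eventually burns everything.
  burnsEventually : ∀ B → Acc _⊃_ B → ∃[ k ] ∃[ xs ] BurnsFrom {k} B xs
  burnsEventually B (acc rec) with all? (_∈? B)
  ... | yes all = 0 , [] , all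
  ... | no ¬all with ¬∀⟶∃¬ n (_∈ B) (_∈? B) ¬all
  ...   | x , x∉B with burnsEventually (burnRound B x) (rec B⊂B′)
    where
    x∈B′ : x ∈ burnRound B x
    x∈B′ = p⊆p∪q (B ∪ neighbours B) (x∈⁅x⁆ x)
    B⊂B′ : B ⊂ burnRound B x
    B⊂B′ = (λ v∈B → q⊆p∪q ⁅ x ⁆ (B ∪ neighbours B) (p⊆p∪q (neighbours B) v∈B))
         , x , x∈B′ , x∉B
  ...     | k , xs , b = suc k , x ∷ xs , x∉B , b

  burningNumber-spec : ∃ (IsMinimum BurnableIn)
  burningNumber-spec =
    let k , burnable = burnsEventually ⊥ (⊃-wellFounded ⊥)
    in minimum (λ k → burnsFrom? k ⊥) k burnable

  burningNumber : ℕ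
  burningNumber = proj₁ burningNumber-spec

  WellBurnable : Set
  WellBurnable = burningNumber ≤ ⌈√ n ⌉

{-# OPTIONS --safe #-}

-- A connected {P₄, C₄}-free graph has a universal vertex c (Wolk).  Burning c
-- first burns everything in two rounds, and 2 ≤ ⌈√ n ⌉ because 2 ≤ n.
-- To find c, climb to larger closed neighbourhoods: if v is not universal,
-- connectedness gives edges v u and u w with w outside N[v].  A vertex t of
-- N[v] outside N[u] would make t, v, u, w induce P₄ or C₄; hence N[v] is
-- properly contained in N[u].
module Submission where

open import Data.Bool using (if_then_else_)
open import Data.Fin using (Fin; zero; suc; _<_)
open import Data.Fin.Properties using (_≟_; <-cmp; all?; any?; ¬∀⟶∃¬; punchInᵢ≢i)
open import Data.Fin.Subset using (Subset; _∈_; _∉_; ⁅_⁆; ⊥; _⊂_; _⊃_)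
open import Data.Fin.Subset.Induction using (⊃-wellFounded)
open import Data.Fin.Subset.Properties
  using (_∈?_; p⊆p∪q; q⊆p∪q; x∈p∪q⁻; x∈⁅x⁆; x∈⁅y⁆⇒x≡y; ∉⊥)
open import Data.List using ([]; _∷_)
open import Data.List.Relation.Unary.All using ([]; _∷_)
open import Data.Nat using (ℕ; suc; _≤_; _*_; s≤s; z≤n)
open import Data.Nat.Properties using (≤-trans)
open import Data.Product using (_×_; _,_; ∃; ∃-syntax; proj₁; proj₂)
open import Data.Sum using (_⊎_; inj₁; inj₂)
open import Data.Vec using ([]; _∷_; tabulate; lookup)
open import Data.Vec.Properties using ([]=⇒lookup; lookup⇒[]=; lookup∘tabulate)
open import Function using (_∘_)
open import Function.Bundles using (_⇔_; mk⇔; module Equivalence)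
open import Induction.WellFounded using (Acc; acc)
open import Relation.Binary.Construct.Closure.ReflexiveTransitive using (Star; ε; _◅_)
open import Relation.Binary.Definitions using (tri<; tri≈; tri>)
open import Relation.Binary.PropositionalEquality using (_≡_; _≢_; refl; sym; trans)
open import Relation.Nullary using (¬_; yes; no; does; contradiction)
open import Relation.Nullary.Decidable using (_×-dec_; _⊎-dec_; decidable-stable; dec-true)
import Relation.Unary as Unary

open import Defs

-- Both `N[_]` and `neighbours` tabulate a decision procedure, so this gives the membership rule for
-- each.
∈-tabulate-does : ∀ {n} {P : Fin n → Set} (P? : Unary.Decidable P) {v} →
                  v ∈ tabulate (does ∘ P?) ⇔ P v
∈-tabulate-does {P = P} P? {v} = mk⇔ to from
  where
  to : v ∈ tabulate (does ∘ P?) → P v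
  -- If `P? v` is `no`, the equation becomes `false ≡ true`, so only the `yes` clause remains.
  to v∈ with P? v | trans (sym (lookup∘tabulate (does ∘ P?) v)) ([]=⇒lookup v∈)
  ... | yes p | _ = p
  from : P v → v ∈ tabulate (does ∘ P?)
  from p = lookup⇒[]= v _ (trans (lookup∘tabulate (does ∘ P?) v) (dec-true (P? v) p))

-- The conditional computes on concrete i, j, so for a concrete H an embedding
-- is given by one adjacency or non-adjacency per pair i < j.
induced-by : ∀ {m n} (H : Graph m) (G : Graph n) (f : Fin m → Fin n) →
             (∀ i j → i < j → f i ≢ f j ×
               (if does (adj? H i j) then Adj G (f i) (f j) else ¬ Adj G (f i) (f j))) →
             H InducedIn G
induced-by H G f pairs = f , injective _ _ , λ i j → mk⇔ (preserves i j) (reflects i j)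
  where
  injective : ∀ i j → f i ≡ f j → i ≡ j
  injective i j fi≡fj with <-cmp i j
  ... | tri< i<j _ _ = contradiction fi≡fj (proj₁ (pairs i j i<j))
  ... | tri≈ _ i≡j _ = i≡j
  ... | tri> _ _ j<i = contradiction (sym fi≡fj) (proj₁ (pairs j i j<i))

  preserves< : ∀ i j → i < j → Adj H i j → Adj G (f i) (f j)
  preserves< i j i<j h with adj? H i j | proj₂ (pairs i j i<j)
  ... | yes _ | g = g
  ... | no ¬h | _ = contradiction h ¬h

  reflects< : ∀ i j → i < j → Adj G (f i) (f j) → Adj H i j
  reflects< i j i<j g with adj? H i j | proj₂ (pairs i j i<j)
  ... | yes h | _  = h
  ... | no _  | ¬g = contradiction g ¬g

  preserves : ∀ i j → Adj H i j → Adj G (f i) (f j)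
  preserves i j h with <-cmp i j
  ... | tri< i<j _ _ = preserves< i j i<j h
  ... | tri≈ _ i≡j _ = contradiction h (irrefl H i≡j)
  ... | tri> _ _ j<i = symm G (preserves< j i j<i (symm H h))

  reflects : ∀ i j → Adj G (f i) (f j) → Adj H i j
  reflects i j g with <-cmp i j
  ... | tri< i<j _ _  = reflects< i j i<j g
  ... | tri≈ _ refl _ = contradiction g (irrefl G refl)
  ... | tri> _ _ j<i  = symm H (reflects< j i j<i (symm G g))

module _ {n} (G : Graph n) where

  adj⇒≢ : ∀ {u v} → Adj G u v → u ≢ v
  adj⇒≢ uv u≡v = irrefl G u≡v uv

  -- The hypotheses settle adjacency for every pair except `t`, `w`: a missing edge leaves the path
  -- induced, a present one closes it to an induced four-cycle.
  path⇒P₄⊎C₄ : ∀ {t v u w} → Adj G t v → Adj G v u → Adj G u w →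
               t ≢ u → ¬ Adj G t u → v ≢ w → ¬ Adj G v w → t ≢ w →
               P₄ InducedIn G ⊎ C₄ InducedIn G
  path⇒P₄⊎C₄ {t} {v} {u} {w} tv vu uw t≢u ¬tu v≢w ¬vw t≢w with adj? G t w
  ... | no ¬tw = inj₁ (induced-by P₄ G (lookup (t ∷ v ∷ u ∷ w ∷ [])) λ where
    zero zero ()
    zero (suc zero) _ → adj⇒≢ tv , tv
    zero (suc (suc zero)) _ → t≢u , ¬tu
    zero (suc (suc (suc zero))) _ → t≢w , ¬tw
    (suc zero) zero ()
    (suc zero) (suc zero) (s≤s ())
    (suc zero) (suc (suc zero)) _ → adj⇒≢ vu , vu
    (suc zero) (suc (suc (suc zero))) _ → v≢w , ¬vw
    (suc (suc zero)) (suc zero) (s≤s ())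
    (suc (suc zero)) (suc (suc zero)) (s≤s (s≤s ()))
    (suc (suc zero)) (suc (suc (suc zero))) _ → adj⇒≢ uw , uw
    (suc (suc (suc zero))) (suc zero) (s≤s ())
    (suc (suc (suc zero))) (suc (suc zero)) (s≤s (s≤s ()))
    (suc (suc (suc zero))) (suc (suc (suc zero))) (s≤s (s≤s (s≤s ()))))
  ... | yes tw = inj₂ (induced-by C₄ G (lookup (t ∷ v ∷ u ∷ w ∷ [])) λ where
    zero zero ()
    zero (suc zero) _ → adj⇒≢ tv , tv
    zero (suc (suc zero)) _ → t≢u , ¬tu
    zero (suc (suc (suc zero))) _ → t≢w , tw
    (suc zero) zero ()
    (suc zero) (suc zero) (s≤s ())
    (suc zero) (suc (suc zero)) _ → adj⇒≢ vu , vu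
    (suc zero) (suc (suc (suc zero))) _ → v≢w , ¬vw
    (suc (suc zero)) (suc zero) (s≤s ())
    (suc (suc zero)) (suc (suc zero)) (s≤s (s≤s ()))
    (suc (suc zero)) (suc (suc (suc zero))) _ → adj⇒≢ uw , uw
    (suc (suc (suc zero))) (suc zero) (s≤s ())
    (suc (suc (suc zero))) (suc (suc zero)) (s≤s (s≤s ()))
    (suc (suc (suc zero))) (suc (suc (suc zero))) (s≤s (s≤s (s≤s ()))))

  -- A walk from inside `S` to outside must cross the boundary; the first crossing edge is returned.
  leaves : ∀ (S : Subset n) {x z} → Star (Adj G) x z → x ∈ S → z ∉ S →
           ∃[ u ] ∃[ w ] u ∈ S × Adj G u w × w ∉ S
  leaves S ε x∈S z∉S = contradiction x∈S z∉S
  leaves S {x} (_◅_ {j = y} xy path) x∈S z∉S with y ∈? S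
  ... | yes y∈S = leaves S path y∈S z∉S
  ... | no  y∉S = x , y , x∈S , xy , y∉S

  -- The closed neighbourhood is a `Subset` so that the climb can recurse on `⊃-wellFounded`.
  N[_] : Fin n → Subset n
  N[ v ] = tabulate λ u → does ((v ≟ u) ⊎-dec adj? G v u)

  ∈N[] : ∀ v {u} → u ∈ N[ v ] ⇔ (v ≡ u ⊎ Adj G v u)
  ∈N[] v = ∈-tabulate-does λ u → (v ≟ u) ⊎-dec adj? G v u

  ∈N⁻ : ∀ v {u} → u ∈ N[ v ] → v ≡ u ⊎ Adj G v u
  ∈N⁻ v = Equivalence.to (∈N[] v)

  ∈N⁺ : ∀ v {u} → v ≡ u ⊎ Adj G v u → u ∈ N[ v ]
  ∈N⁺ v = Equivalence.from (∈N[] v)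

  N[]-⊂ : ¬ P₄ InducedIn G → ¬ C₄ InducedIn G →
          ∀ {v u w} → Adj G v u → Adj G u w → w ∉ N[ v ] → N[ v ] ⊂ N[ u ]
  N[]-⊂ ¬P₄ ¬C₄ {v} {u} {w} vu uw w∉Nv =
    -- Forbidden subgraphs only refute `t ∉ N[ u ]`; decidability turns this into membership.
    -- Strictness is witnessed by `w`.
    (λ t∈Nv → decidable-stable (_ ∈? N[ u ]) (nested t∈Nv)) , w , ∈N⁺ u (inj₂ uw) , w∉Nv
    where
    nested : ∀ {t} → t ∈ N[ v ] → ¬ t ∉ N[ u ]
    nested t∈Nv t∉Nu with ∈N⁻ v t∈Nv
    ... | inj₁ refl = t∉Nu (∈N⁺ u (inj₂ (symm G vu)))
    ... | inj₂ vt with path⇒P₄⊎C₄ (symm G vt) vu uw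
                         (λ t≡u → t∉Nu (∈N⁺ u (inj₁ (sym t≡u))))
                         (λ tu → t∉Nu (∈N⁺ u (inj₂ (symm G tu))))
                         (λ v≡w → w∉Nv (∈N⁺ v (inj₁ v≡w)))
                         (λ vw → w∉Nv (∈N⁺ v (inj₂ vw)))
                         (λ { refl → w∉Nv t∈Nv })
    ...   | inj₁ p = ¬P₄ p
    ...   | inj₂ c = ¬C₄ c

  Universal : Fin n → Set
  Universal c = ∀ v → v ∈ N[ c ]

  universal-vertex : Connected G → ¬ P₄ InducedIn G → ¬ C₄ InducedIn G →
                     Fin n → ∃ Universal
  universal-vertex conn ¬P₄ ¬C₄ v₀ = climb v₀ (⊃-wellFounded N[ v₀ ])
    where
    climb : ∀ v → Acc _⊃_ N[ v ] → ∃ Universal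
    climb v (acc rec) with all? (_∈? N[ v ])
    ... | yes all = v , all
    ... | no ¬all with ¬∀⟶∃¬ n (_∈ N[ v ]) (_∈? N[ v ]) ¬all
    ...   | z , z∉Nv with leaves N[ v ] (conn v z) (∈N⁺ v (inj₁ refl)) z∉Nv
    ...     | u , w , u∈Nv , uw , w∉Nv with ∈N⁻ v u∈Nv
    -- A crossing edge cannot start at `v` itself, since its end would then lie in `N[ v ]`.
    ...       | inj₁ refl = contradiction (∈N⁺ v (inj₂ uw)) w∉Nv
    ...       | inj₂ vu   = climb u (rec (N[]-⊂ ¬P₄ ¬C₄ vu uw w∉Nv))

  ∈neighbours : ∀ B {v} → v ∈ neighbours G B ⇔ (∃[ u ] u ∈ B × Adj G u v)
  ∈neighbours B = ∈-tabulate-does λ v → any? λ u → (u ∈? B) ×-dec adj? G u v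

  -- No fire exists before the first round, so nothing spreads in it. Hence any vertex other than
  -- `c` is a legal second source.
  burnRound-⊥ : ∀ c {v} → v ∈ burnRound G ⊥ c → v ≡ c
  burnRound-⊥ c v∈ with x∈p∪q⁻ ⁅ c ⁆ _ v∈
  ... | inj₁ v∈⁅c⁆ = x∈⁅y⁆⇒x≡y c v∈⁅c⁆
  ... | inj₂ v∈′ with x∈p∪q⁻ ⊥ _ v∈′
  ...   | inj₁ v∈⊥ = contradiction v∈⊥ ∉⊥
  ...   | inj₂ v∈N with Equivalence.to (∈neighbours ⊥) v∈N
  ...     | _ , u∈⊥ , _ = contradiction u∈⊥ ∉⊥

  -- The fire at `c` reaches all its neighbours in round two; `x` is there because each round must
  -- have an unburned source.
  burnable-in-2 : ∀ {c x} → Universal c → x ≢ c → BurnableIn G 2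
  burnable-in-2 {c} {x} univ x≢c = c ∷ x ∷ [] , ∉⊥ , (λ x∈ → x≢c (burnRound-⊥ c x∈)) , burned
    where
    B = burnRound G ⊥ c

    c∈B : c ∈ B
    c∈B = p⊆p∪q _ (x∈⁅x⁆ c)

    burned : ∀ v → v ∈ burnRound G B x
    burned v with ∈N⁻ c (univ v)
    ... | inj₁ refl = q⊆p∪q ⁅ x ⁆ _ (p⊆p∪q _ c∈B)
    ... | inj₂ cv   = q⊆p∪q ⁅ x ⁆ _ (q⊆p∪q B _ (Equivalence.from (∈neighbours B) (c , c∈B , cv)))

  burningNumber-≤ : ∀ {k} → BurnableIn G k → burningNumber G ≤ k
  burningNumber-≤ = proj₂ (proj₂ (burningNumber-spec G)) _

n≤⌈√n⌉² : ∀ n → n ≤ ⌈√ n ⌉ * ⌈√ n ⌉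
n≤⌈√n⌉² n = proj₁ (proj₂ ⌈√ n ⌉-spec)

-- Meant for `⌈√ n ⌉`: the squares of 0 and 1 are below 2.
2≤n²⇒2≤n : ∀ n → 2 ≤ n * n → 2 ≤ n
2≤n²⇒2≤n 1             (s≤s ())
2≤n²⇒2≤n (suc (suc n)) _ = s≤s (s≤s z≤n)

mainTheorem6 : (n : ℕ) (G : Graph n) → 2 ≤ n → Connected G → (K₂+2K₁ ∷ P₄ ∷ C₄ ∷ []) -Free G → WellBurnable G
mainTheorem6 1 G (s≤s ())
mainTheorem6 n@(suc (suc _)) G 2≤n conn (_ ∷ ¬P₄ ∷ ¬C₄ ∷ []) =
  let c , univ = universal-vertex G conn ¬P₄ ¬C₄ zero
  -- The second source is `punchIn c zero`, a vertex other than `c`, which exists because `n` is at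
  -- least 2.
  in ≤-trans (burningNumber-≤ G (burnable-in-2 G univ (punchInᵢ≢i c zero)))
             (2≤n²⇒2≤n ⌈√ n ⌉ (≤-trans 2≤n (n≤⌈√n⌉² n)))
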